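{- Let $n\ge 2$ and let $P=[p_1,\ldots,p_n]$ be an arithmetically progressed permutation with ratio $k$ such that $p_1\notin\{1,k+1,n\}$. Then the associated ternary string $\mathsf{T}_P$ is the unique string of length $n$ over $\{\mathtt{a},\mathtt{b},\mathtt{c}\}$ whose suffix array is $P$.
   Context: Alphabet $\{\mathtt{a}<\mathtt{b}<\mathtt{c}\}$, lexicographic order with a proper prefix smaller than the longer string; suffix array $\mathsf{SA}_{\mathsf{T}}$: permutation of $[1..n]$ such that $\mathsf{T}[\mathsf{SA}_{\mathsf{T}}[i]..n]$ is the $i$-th smallest suffix. $x\bmod n$ denotes the representative of $x$ modulo $n$ in $[1..n]$. An arithmetically progressed permutation of length $n$ with ratio $k\in[1..n-1]$ is a permutation $P=[p_1,\ldots,p_n]$ of $[1..n]$ with $p_{i+1}=p_i+k\bmod n$. Ternary string associated with $P$: cut $P$ immediately after the entry $n-k$ and immediately after the entry $(p_1-k-1)\bmod n$, giving consecutive possibly empty blocks $A,B,C$ with $P=ABC$; set $\mathsf{T}_P[p_i]=\mathtt{a},\mathtt{b},\mathtt{c}$ according as $p_i$ lies in $A$, $B$, $C$. -}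

module Defs where

open import Data.Bool.Base using (if_then_else_)
open import Data.Fin.Base as Fin using (Fin; zero; toℕ; fromℕ<)
open import Data.Fin.Patterns using (0F; 1F; 2F)
open import Data.Fin.Permutation using (Permutation′; _⟨$⟩ʳ_; _⟨$⟩ˡ_)
open import Data.Integer.Base as ℤ using (ℤ; +_; 1ℤ; _%ℕ_)
open import Data.Integer.DivMod using (n%ℕd<d)
open import Data.List.Base as List using (List)
open import Data.List.Relation.Binary.Lex.Strict using (Lex-<)
open import Data.Nat.Base using (ℕ; suc; NonZero; _≤_; _<_; _<ᵇ_; _⊓_; _⊔_)
open import Data.Vec.Base as Vec using (Vec)
open import Relation.Binary.PropositionalEquality.Core using (_≡_)

private
  variable
    n : ℕ

Letter : Set
Letter = Fin 3

pattern 𝚊 = 0F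
pattern 𝚋 = 1F
pattern 𝚌 = 2F

String : ℕ → Set
String n = Vec Letter n

-- Lex-< makes a proper prefix smaller than the longer list.
infix 4 _≺_
_≺_ : List Letter → List Letter → Set
_≺_ = Lex-< _≡_ Fin._<_

-- Text positions and array indices range over [1..n]; both are encoded by
-- Fin n, where x : Fin n stands for the number ⟦ x ⟧ = 1 + toℕ x.
⟦_⟧ : Fin n → ℕ
⟦ x ⟧ = suc (toℕ x)

-- The element of [1..n] congruent to z modulo n: the number it stands for
-- is 1 + ((z - 1) %ℕ n).
infixl 5 _mod₁_
_mod₁_ : ℤ → (n : ℕ) .{{_ : NonZero n}} → Fin n
z mod₁ n = fromℕ< (n%ℕd<d (z ℤ.- 1ℤ) n)

suffix : String n → Fin n → List Letter
suffix T x = List.drop (toℕ x) (Vec.toList T)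

IsSuffixArray : String n → Permutation′ n → Set
IsSuffixArray T P =
  ∀ i j → i Fin.< j → suffix T (P ⟨$⟩ʳ i) ≺ suffix T (P ⟨$⟩ʳ j)

record ArithmeticallyProgressed (n : ℕ) .{{_ : NonZero n}}
                                (k : ℕ) (P : Permutation′ n) : Set where
  field
    1≤k  : 1 ≤ k
    k<n  : k < n
    step : ∀ i j → toℕ j ≡ suc (toℕ i) →
           P ⟨$⟩ʳ j ≡ (+ ⟦ P ⟨$⟩ʳ i ⟧ ℤ.+ + k) mod₁ n

first : .{{_ : NonZero n}} → Permutation′ n → Fin n
first {n = suc _} P = P ⟨$⟩ʳ zero

module _ (n : ℕ) .{{_ : NonZero n}} (k : ℕ) (P : Permutation′ n) where

  -- Index in [1..n] at which an entry occurs in P, which is also the length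
  -- of the part of P up to and including that entry.
  index : Fin n → ℕ
  index x = ⟦ P ⟨$⟩ˡ x ⟧

  -- The first cut entry is n - k itself, as 1 ≤ k < n.
  cut₁ cut₂ : ℕ
  cut₁ = index ((+ n ℤ.- + k) mod₁ n)
  cut₂ = index ((+ ⟦ first P ⟧ ℤ.- + k ℤ.- 1ℤ) mod₁ n)

  -- The two cuts may occur in P in either order.  The block A consists of the
  -- first cut₁ ⊓ cut₂ entries, and A and B together of the first cut₁ ⊔ cut₂.
  letterOf : Fin n → Letter
  letterOf x =
    if toℕ (P ⟨$⟩ˡ x) <ᵇ cut₁ ⊓ cut₂ then 𝚊 else
    if toℕ (P ⟨$⟩ˡ x) <ᵇ cut₁ ⊔ cut₂ then 𝚋 else 𝚌

  ternaryString : String n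
  ternaryString = Vec.tabulate letterOf

{-# OPTIONS --safe #-}
-- Call x, y consecutive if y immediately follows x in P, so that y ≡ x + k.
-- Then x + 1 and y + 1 are again consecutive, except when y = n (x is the cut
-- entry n - k), when y + 1 heads P (x is the other cut entry), or when x = n
-- (the suffix at x is a single letter).  Hence suffixes of consecutive entries
-- compare correctly as soon as the letters weakly increase along P, strictly
-- at the two cuts; conversely, a text with suffix array P must strictly
-- increase at both cuts, and over three letters two strict increases determine
-- the text.
module Submission where

open import Defs
open import Data.Bool.Base using (if_then_else_)
open import Data.Empty using (⊥-elim)
open import Data.Fin.Base as Fin using (Fin; zero; suc; toℕ; fromℕ<)
open import Data.Fin.Patterns using (1F)
open import Data.Fin.Permutation using (Permutation′; _⟨$⟩ʳ_; _⟨$⟩ˡ_; inverseˡ; inverseʳ)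
import Data.Fin.Properties as Fin
open import Data.Integer.Base as ℤ using (+_; -[1+_]; 1ℤ; _%ℕ_; _/ℕ_)
open import Data.Integer.DivMod using (n%ℕd<d; a≡a%ℕn+[a/ℕn]*n)
import Data.Integer.Properties as ℤ
import Data.Integer.Tactic.RingSolver as ℤ
open import Data.List.Base using ([]; _∷_)
open import Data.List.Relation.Binary.Lex.Strict
  using (base; this; next; halt; <-transitive; <-asymmetric)
open import Data.Nat.Base
  using (ℕ; zero; suc; NonZero; _+_; _*_; _%_; _≤_; _<_; _<ᵇ_; z≤n; s≤s; s<s)
open import Data.Nat.DivMod
  using (%-distribˡ-+; [m+n]%n≡m%n; [m+kn]%n≡m%n; m<n⇒m%n≡m; m%n<n; m%n%n≡m%n; n%n≡0)
open import Data.Nat.Properties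
open import Data.Product.Base using (_×_; _,_; ∃-syntax)
open import Data.Sum.Base using (_⊎_; inj₁; inj₂)
open import Data.Vec.Base using (_∷_; []; lookup)
open import Data.Vec.Properties using (lookup∘tabulate; tabulate∘lookup; tabulate-cong)
open import Function.Base using (_∘_)
open import Relation.Binary.Core using (Rel)
open import Relation.Binary.Definitions using (Transitive; Asymmetric; tri<; tri≈; tri>)
open import Relation.Binary.PropositionalEquality
  using (_≡_; _≢_; refl; sym; trans; cong; cong₂; subst; subst₂; resp₂; isEquivalence;
         module ≡-Reasoning)
open import Relation.Nullary.Decidable.Core using (yes; no)
open import Relation.Nullary.Reflects using (ofʸ; ofⁿ)

private
  variable
    n : ℕ

-- Residues modulo `n` and their representatives.

module _ (n : ℕ) .{{_ : NonZero n}} where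

  %-congˡ-+ : ∀ a b c → a % n ≡ b % n → (a + c) % n ≡ (b + c) % n
  %-congˡ-+ a b c eq = begin
    (a + c) % n          ≡⟨ %-distribˡ-+ a c n ⟩
    (a % n + c % n) % n  ≡⟨ cong (λ r → (r + c % n) % n) eq ⟩
    (b % n + c % n) % n  ≡⟨ %-distribˡ-+ b c n ⟨
    (b + c) % n          ∎
    where open ≡-Reasoning

  suc-% : ∀ a → suc (a % n) % n ≡ suc a % n
  suc-% a = subst₂ (λ x y → x % n ≡ y % n) (+-comm (a % n) 1) (+-comm a 1)
              (%-congˡ-+ (a % n) a 1 (m%n%n≡m%n a n))

toℕ-% : (x : Fin n) .{{_ : NonZero n}} → toℕ x % n ≡ toℕ x
toℕ-% x = m<n⇒m%n≡m (Fin.toℕ<n x)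

+-%-injective : ∀ d .{{_ : NonZero n}} {x y : Fin n} →
                (toℕ x + d) % n ≡ (toℕ y + d) % n → x ≡ y
+-%-injective {n@(suc m)} d {x} {y} eq = Fin.toℕ-injective (begin
  toℕ x                    ≡⟨ undo x ⟨
  (toℕ x + d + m * d) % n  ≡⟨ %-congˡ-+ n (toℕ x + d) (toℕ y + d) (m * d) eq ⟩
  (toℕ y + d + m * d) % n  ≡⟨ undo y ⟩
  toℕ y                    ∎)
  where
  open ≡-Reasoning
  undo : ∀ z → (toℕ z + d + m * d) % n ≡ toℕ z
  undo z = begin
    (toℕ z + d + m * d) % n  ≡⟨ cong (_% n) (+-assoc (toℕ z) d (m * d)) ⟩
    (toℕ z + n * d) % n      ≡⟨ cong (λ e → (toℕ z + e) % n) (*-comm n d) ⟩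
    (toℕ z + d * n) % n      ≡⟨ [m+kn]%n≡m%n (toℕ z) d n ⟩
    toℕ z % n                ≡⟨ toℕ-% z ⟩
    toℕ z                    ∎

ℤ-cong⇒% : ∀ {a b} q n .{{_ : NonZero n}} → + a ℤ.+ q ℤ.* + n ≡ + b → a % n ≡ b % n
ℤ-cong⇒% {a} (+ q) n eq = trans (sym ([m+kn]%n≡m%n a q n)) (cong (_% n)
  (ℤ.+-injective (trans (cong (λ z → + a ℤ.+ z) (ℤ.pos-* q n)) eq)))
-- With a negative quotient, the multiple of `n` moves to the side of `b`, where it is a natural
-- number.
ℤ-cong⇒% {a} {b} -[1+ q ] n eq = trans (cong (_% n) (ℤ.+-injective (begin
  + a                                        ≡⟨ cancel (+ a) (+ suc q) (+ n) ⟩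
  + a ℤ.+ -[1+ q ] ℤ.* + n ℤ.+ + suc q ℤ.* + n  ≡⟨ cong (ℤ._+ + suc q ℤ.* + n) eq ⟩
  + b ℤ.+ + suc q ℤ.* + n                    ≡⟨ cong (λ z → + b ℤ.+ z) (ℤ.pos-* (suc q) n) ⟨
  + (b + suc q * n)                          ∎)))
  ([m+kn]%n≡m%n b (suc q) n)
  where
  open ≡-Reasoning
  cancel : ∀ a s n → a ≡ a ℤ.+ (ℤ.- s) ℤ.* n ℤ.+ s ℤ.* n
  cancel = ℤ.solve-∀

-- The summand `d` compensates for the subtractions in `z`, turning the integer remainder inside
-- `mod₁` into `%` on naturals. The `suc` on the right reflects that `toℕ` is one less than the
-- entry meant.
mod₁-% : ∀ z d m n .{{_ : NonZero n}} → z ℤ.+ + d ≡ + suc m →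
         (toℕ (z mod₁ n) + d) % n ≡ m % n
mod₁-% z d m n eq = ℤ-cong⇒% q n (begin
  + toℕ (z mod₁ n) ℤ.+ + d ℤ.+ q ℤ.* + n
    ≡⟨ cong (λ t → + t ℤ.+ + d ℤ.+ q ℤ.* + n) (Fin.toℕ-fromℕ< (n%ℕd<d (z ℤ.- 1ℤ) n)) ⟩
  + r ℤ.+ + d ℤ.+ q ℤ.* + n    ≡⟨ swap (+ r) (+ d) (q ℤ.* + n) ⟩
  + r ℤ.+ q ℤ.* + n ℤ.+ + d    ≡⟨ cong (ℤ._+ + d) (a≡a%ℕn+[a/ℕn]*n (z ℤ.- 1ℤ) n) ⟨
  z ℤ.- 1ℤ ℤ.+ + d             ≡⟨ swap z (ℤ.- 1ℤ) (+ d) ⟩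
  z ℤ.+ + d ℤ.- 1ℤ             ≡⟨ cong (ℤ._- 1ℤ) eq ⟩
  + m                          ∎)
  where
  open ≡-Reasoning
  q = (z ℤ.- 1ℤ) /ℕ n
  r = (z ℤ.- 1ℤ) %ℕ n
  swap : ∀ a b c → a ℤ.+ b ℤ.+ c ≡ a ℤ.+ c ℤ.+ b
  swap = ℤ.solve-∀

-- Suffixes and their lexicographic order.

≺-trans : Transitive _≺_
≺-trans = <-transitive isEquivalence (resp₂ Fin._<_) <-trans

≺-asym : Asymmetric _≺_
≺-asym = <-asymmetric sym (resp₂ Fin._<_) <-asym

≺-head : ∀ {a b as bs} → (a ∷ as) ≺ (b ∷ bs) → a Fin.< b ⊎ a ≡ b × as ≺ bs
≺-head (this a<b)    = inj₁ a<b
≺-head (next eq lt) = inj₂ (eq , lt)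

suffix-last : (T : String n) {x : Fin n} → suc (toℕ x) ≡ n →
              suffix T x ≡ lookup T x ∷ []
suffix-last (a ∷ [])     {zero}  _  = refl
suffix-last (a ∷ _ ∷ _)  {zero}  ()
suffix-last (a ∷ T)      {suc x} eq = suffix-last T (suc-injective eq)

suffix-suc : (T : String n) {x y : Fin n} → toℕ y ≡ suc (toℕ x) →
             suffix T x ≡ lookup T x ∷ suffix T y
suffix-suc (a ∷ b ∷ T) {zero}  {suc zero} _  = refl
suffix-suc (a ∷ T)     {suc x} {suc y}    eq = suffix-suc T (suc-injective eq)

last⊎suc : (x : Fin n) → suc (toℕ x) ≡ n ⊎ (∃[ y ] toℕ {n} y ≡ suc (toℕ x))
last⊎suc x with m≤n⇒m<n∨m≡n (Fin.toℕ<n x)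
... | inj₁ lt = inj₂ (fromℕ< lt , Fin.toℕ-fromℕ< lt)
... | inj₂ eq = inj₁ eq

suffix-head : (T : String n) (x : Fin n) → ∃[ as ] suffix T x ≡ lookup T x ∷ as
suffix-head T x with last⊎suc x
... | inj₁ eq       = _ , suffix-last T eq
... | inj₂ (y , eq) = _ , suffix-suc T eq

successor⇒< : ∀ {a ℓ} {A : Set a} (_⊏_ : Rel A ℓ) → Transitive _⊏_ → (f : Fin n → A) →
              (∀ i j → toℕ j ≡ suc (toℕ i) → f i ⊏ f j) →
              ∀ i j → i Fin.< j → f i ⊏ f j
successor⇒< _⊏_ tr f s zero    (suc zero)    _       = s zero 1F refl
successor⇒< _⊏_ tr f s zero    (suc (suc j)) _       =
  tr (s zero 1F refl)
     (successor⇒< _⊏_ tr (f ∘ suc) (λ i j eq → s (suc i) (suc j) (cong suc eq)) zero (suc j) (s≤s z≤n))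
successor⇒< _⊏_ tr f s (suc i) (suc j)       (s<s p) =
  successor⇒< _⊏_ tr (f ∘ suc) (λ i j eq → s (suc i) (suc j) (cong suc eq)) i j p

-- Letters of a string made of three blocks.

three-letters : ∀ {x y z : Letter} → x Fin.< y → y Fin.< z → x ≡ 𝚊 × y ≡ 𝚋 × z ≡ 𝚌
three-letters {𝚊} {𝚋} {𝚌} _ _ = refl , refl , refl
three-letters {𝚊} {𝚋} {𝚊} _ ()
three-letters {𝚊} {𝚋} {𝚋} _ (s≤s ())
three-letters {𝚋} {𝚋} (s≤s ())
three-letters {𝚌} {𝚋} (s≤s ())
three-letters {_} {𝚌} {𝚋} _ (s≤s ())
three-letters {_} {𝚌} {𝚌} _ (s≤s (s≤s ()))

-- The body of `letterOf` with rank and block boundaries abstracted, so that `letterOf` unfolds to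
-- it. The boundaries are prefix lengths of `P`: one more than the rank of a cut entry.
blockLetter : ℕ → ℕ → ℕ → Letter
blockLetter l h r = if r <ᵇ l then 𝚊 else if r <ᵇ h then 𝚋 else 𝚌

module _ (l h : ℕ) {r : ℕ} where

  blockLetter-𝚊 : r < l → blockLetter l h r ≡ 𝚊
  blockLetter-𝚊 r<l with r <ᵇ l | <ᵇ-reflects-< r l
  ... | _ | ofʸ _   = refl
  ... | _ | ofⁿ r≮l = ⊥-elim (r≮l r<l)

  blockLetter-𝚋 : l ≤ r → r < h → blockLetter l h r ≡ 𝚋
  blockLetter-𝚋 l≤r r<h with r <ᵇ l | <ᵇ-reflects-< r l | r <ᵇ h | <ᵇ-reflects-< r h
  ... | _ | ofʸ r<l | _ | _       = ⊥-elim (<⇒≱ r<l l≤r)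
  ... | _ | ofⁿ _   | _ | ofʸ _   = refl
  ... | _ | ofⁿ _   | _ | ofⁿ r≮h = ⊥-elim (r≮h r<h)

  blockLetter-𝚌 : l ≤ r → h ≤ r → blockLetter l h r ≡ 𝚌
  blockLetter-𝚌 l≤r h≤r with r <ᵇ l | <ᵇ-reflects-< r l | r <ᵇ h | <ᵇ-reflects-< r h
  ... | _ | ofʸ r<l | _ | _       = ⊥-elim (<⇒≱ r<l l≤r)
  ... | _ | ofⁿ _   | _ | ofʸ r<h = ⊥-elim (<⇒≱ r<h h≤r)
  ... | _ | ofⁿ _   | _ | ofⁿ _   = refl

-- Comparing `suc r` with both boundaries suffices: the letter changes exactly when `suc r` is one
-- of them.
blockLetter-suc : ∀ l h r → l < h →
  blockLetter l h r Fin.< blockLetter l h (suc r) ⊎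
  blockLetter l h r ≡ blockLetter l h (suc r) × suc r ≢ l × suc r ≢ h
blockLetter-suc l h r l<h with <-cmp (suc r) l | <-cmp (suc r) h
... | tri< r+1<l ≢l _ | _
  rewrite blockLetter-𝚊 l h (<-trans (n<1+n r) r+1<l) | blockLetter-𝚊 l h r+1<l
  = inj₂ (refl , ≢l , <⇒≢ (<-trans r+1<l l<h))
... | tri≈ _ refl _ | _
  rewrite blockLetter-𝚊 l h (n<1+n r) | blockLetter-𝚋 l h ≤-refl l<h
  = inj₁ (s≤s z≤n)
... | tri> _ ≢l (s≤s l≤r) | tri< r+1<h ≢h _
  rewrite blockLetter-𝚋 l h l≤r (<-trans (n<1+n r) r+1<h)
        | blockLetter-𝚋 l h (m≤n⇒m≤1+n l≤r) r+1<h
  = inj₂ (refl , ≢l , ≢h)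
... | tri> _ _ (s≤s l≤r) | tri≈ _ refl _
  rewrite blockLetter-𝚋 l h l≤r (n<1+n r) | blockLetter-𝚌 l h (m≤n⇒m≤1+n l≤r) ≤-refl
  = inj₁ (s≤s (s≤s z≤n))
... | tri> _ ≢l (s≤s l≤r) | tri> _ ≢h (s≤s h≤r)
  rewrite blockLetter-𝚌 l h l≤r h≤r
        | blockLetter-𝚌 l h (m≤n⇒m≤1+n l≤r) (m≤n⇒m≤1+n h≤r)
  = inj₂ (refl , ≢l , ≢h)

-- Consecutive entries of `P` and the two cut entries.

module _ (m k : ℕ) (P : Permutation′ (suc m))
         (ap : ArithmeticallyProgressed (suc m) k P) where

  open ArithmeticallyProgressed ap

  private
    N : ℕ
    N = suc m

    q₀ c₁ c₂ : Fin N
    q₀ = first P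
    c₁ = (+ N ℤ.- + k) mod₁ N
    c₂ = (+ ⟦ q₀ ⟧ ℤ.- + k ℤ.- 1ℤ) mod₁ N

  rank : Fin N → ℕ
  rank x = toℕ (P ⟨$⟩ˡ x)

  rank-injective : ∀ {x y} → rank x ≡ rank y → x ≡ y
  rank-injective {x} {y} eq = begin
    x                   ≡⟨ inverseʳ P ⟨
    P ⟨$⟩ʳ (P ⟨$⟩ˡ x)   ≡⟨ cong (P ⟨$⟩ʳ_) (Fin.toℕ-injective eq) ⟩
    P ⟨$⟩ʳ (P ⟨$⟩ˡ y)   ≡⟨ inverseʳ P ⟩
    y                   ∎
    where open ≡-Reasoning

  rank-q₀ : rank q₀ ≡ 0
  rank-q₀ = cong toℕ (inverseˡ P)

  -- Defined by rank and not by adding `k`: the sum also leads from the last entry of `P` back to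
  -- `q₀`, which has no predecessor in `P`.
  infix 4 _⟶_
  _⟶_ : Fin N → Fin N → Set
  x ⟶ y = rank y ≡ suc (rank x)

  ⟶⇒+k : ∀ {x y} → x ⟶ y → (toℕ x + k) % N ≡ toℕ y
  ⟶⇒+k {x} {y} x⟶y = begin
    (toℕ x + k) % N  ≡⟨ mod₁-% (+ ⟦ x ⟧ ℤ.+ + k) 0 (toℕ x + k) N (ℤ.+-identityʳ _) ⟨
    (toℕ z + 0) % N  ≡⟨ cong (_% N) (+-identityʳ (toℕ z)) ⟩
    toℕ z % N        ≡⟨ toℕ-% z ⟩
    toℕ z            ≡⟨ cong toℕ y≡z ⟨
    toℕ y            ∎
    where
    open ≡-Reasoning
    z : Fin N
    z = (+ ⟦ x ⟧ ℤ.+ + k) mod₁ N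
    y≡z : y ≡ z
    y≡z = subst₂ (λ u v → u ≡ (+ ⟦ v ⟧ ℤ.+ + k) mod₁ N) (inverseʳ P) (inverseʳ P)
            (step _ _ x⟶y)

  -- As `y` does not head `P`, it has a predecessor `x′` there, and `x′ + k` is congruent to `y`
  -- too; adding `k` is injective, so `x′` is `x`.
  +k⇒⟶ : ∀ {x y} → (toℕ x + k) % N ≡ toℕ y → y ≢ q₀ → x ⟶ y
  +k⇒⟶ {x} {y} eq y≢q₀ with P ⟨$⟩ˡ y in Pˡy≡
  ... | zero  = ⊥-elim (y≢q₀ (trans (sym (inverseʳ P)) (cong (P ⟨$⟩ʳ_) Pˡy≡)))
  ... | suc j = cong suc (trans (sym rank-x′) (cong rank x′≡x))
    where
    x′ : Fin N
    x′ = P ⟨$⟩ʳ Fin.inject₁ j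
    rank-x′ : rank x′ ≡ toℕ j
    rank-x′ = trans (cong toℕ (inverseˡ P)) (Fin.toℕ-inject₁ j)
    x′≡x : x′ ≡ x
    x′≡x = +-%-injective k
      (trans (⟶⇒+k (trans (cong toℕ Pˡy≡) (cong suc (sym rank-x′)))) (sym eq))

  ⟶-shift : ∀ {x y} → x ⟶ y → (toℕ x + suc k) % N ≡ suc (toℕ y) % N
  ⟶-shift {x} {y} x⟶y = begin
    (toℕ x + suc k) % N      ≡⟨ cong (_% N) (+-suc (toℕ x) k) ⟩
    suc (toℕ x + k) % N      ≡⟨ suc-% N (toℕ x + k) ⟨
    suc ((toℕ x + k) % N) % N ≡⟨ cong (λ t → suc t % N) (⟶⇒+k {x} {y} x⟶y) ⟩
    suc (toℕ y) % N          ∎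
    where open ≡-Reasoning

  ⟶-suc : ∀ {x y} {x⁺ y⁺ : Fin N} → x ⟶ y → toℕ x⁺ ≡ suc (toℕ x) → toℕ y⁺ ≡ suc (toℕ y) →
          (toℕ x⁺ + k) % N ≡ toℕ y⁺
  ⟶-suc {x} {y} {x⁺} {y⁺} x⟶y x⁺≡ y⁺≡ = begin
    (toℕ x⁺ + k) % N     ≡⟨ cong (λ t → (t + k) % N) x⁺≡ ⟩
    suc (toℕ x + k) % N  ≡⟨ cong (_% N) (+-suc (toℕ x) k) ⟨
    (toℕ x + suc k) % N  ≡⟨ ⟶-shift {x} {y} x⟶y ⟩
    suc (toℕ y) % N      ≡⟨ cong (_% N) y⁺≡ ⟨
    toℕ y⁺ % N           ≡⟨ toℕ-% y⁺ ⟩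
    toℕ y⁺               ∎
    where open ≡-Reasoning

  -- Adding `suc k` leads to the cyclic successor of the position `k` further on. The value 0 says
  -- that `c₁ + k` is the last text position; `c₂-%` says that `c₂ + k` lies cyclically just before
  -- `q₀`.
  c₁-% : (toℕ c₁ + suc k) % N ≡ 0
  c₁-% = trans (mod₁-% (+ N ℤ.- + k) (suc k) N N (regroup (+ N) (+ k))) (n%n≡0 N)
    where
    regroup : ∀ a b → a ℤ.- b ℤ.+ (1ℤ ℤ.+ b) ≡ 1ℤ ℤ.+ a
    regroup = ℤ.solve-∀

  c₂-% : (toℕ c₂ + suc k) % N ≡ toℕ q₀
  c₂-% = trans (mod₁-% (+ ⟦ q₀ ⟧ ℤ.- + k ℤ.- 1ℤ) (suc k) (toℕ q₀) N (regroup (+ ⟦ q₀ ⟧) (+ k)))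
               (toℕ-% q₀)
    where
    regroup : ∀ a b → a ℤ.- b ℤ.- 1ℤ ℤ.+ (1ℤ ℤ.+ b) ≡ a
    regroup = ℤ.solve-∀

  -- Adding `suc k` is injective and sends both `x` and `c₁` to 0.
  ⟶last⇒c₁ : ∀ {x y} → x ⟶ y → suc (toℕ y) ≡ N → x ≡ c₁
  ⟶last⇒c₁ x⟶y eq = +-%-injective (suc k)
    (trans (⟶-shift x⟶y) (trans (cong (_% N) eq) (trans (n%n≡0 N) (sym c₁-%))))

  ⟶pred-q₀⇒c₂ : ∀ {x y} → x ⟶ y → toℕ q₀ ≡ suc (toℕ y) → x ≡ c₂
  ⟶pred-q₀⇒c₂ x⟶y eq = +-%-injective (suc k)
    (trans (⟶-shift x⟶y) (trans (cong (_% N) (sym eq)) (trans (toℕ-% q₀) (sym c₂-%))))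

  -- A local condition on letters that makes `P` the suffix array.

  StepUp : String N → Fin N → Fin N → Set
  StepUp T x y = lookup T x Fin.< lookup T y ⊎
                 lookup T x ≡ lookup T y × x ≢ c₁ × x ≢ c₂

  module _ (T : String N) (up : ∀ {x y} → x ⟶ y → StepUp T x y) where

    -- Induction on `f`, the length of the suffix at `y`. On equal first letters both suffixes lose
    -- one letter; since `x` is no cut, the shifted positions are again consecutive in `P`, unless
    -- `x` ends the text.
    suffix-⟶ : ∀ f {x y} → toℕ y + f ≡ N → x ⟶ y → suffix T x ≺ suffix T y
    suffix-⟶ zero {x} {y} eq _ =
      ⊥-elim (<⇒≢ (Fin.toℕ<n y) (trans (sym (+-identityʳ (toℕ y))) eq))
    suffix-⟶ (suc f) {x} {y} eq x⟶y with up x⟶y | last⊎suc y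
    ... | inj₁ Tx<Ty | _ with _ , eqx ← suffix-head T x | _ , eqy ← suffix-head T y
      rewrite eqx | eqy = this Tx<Ty
    ... | inj₂ (_ , x≢c₁ , _) | inj₁ y-last = ⊥-elim (x≢c₁ (⟶last⇒c₁ x⟶y y-last))
    ... | inj₂ (Tx≡Ty , _ , x≢c₂) | inj₂ (y⁺ , y⁺≡) with last⊎suc x
    -- The suffix at `x` is a single letter, hence a proper prefix of the suffix at `y`.
    ...   | inj₁ x-last with _ , eqy⁺ ← suffix-head T y⁺
      rewrite suffix-last T x-last | suffix-suc T y⁺≡ | eqy⁺ = next Tx≡Ty halt
    ...   | inj₂ (x⁺ , x⁺≡)
      rewrite suffix-suc T x⁺≡ | suffix-suc T y⁺≡ = next Tx≡Ty
        (suffix-⟶ f {x⁺} {y⁺} (trans (cong (_+ f) y⁺≡) (trans (sym (+-suc (toℕ y) f)) eq))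
          (+k⇒⟶ {x⁺} {y⁺} (⟶-suc {x} {y} x⟶y x⁺≡ y⁺≡)
            λ { refl → x≢c₂ (⟶pred-q₀⇒c₂ x⟶y y⁺≡) }))

    isSuffixArray : IsSuffixArray T P
    isSuffixArray = successor⇒< _≺_ ≺-trans (λ i → suffix T (P ⟨$⟩ʳ i)) λ i j j≡1+i →
      suffix-⟶ _ (m+[n∸m]≡n (Fin.toℕ≤n (P ⟨$⟩ʳ j)))
        (trans (cong toℕ (inverseˡ P)) (trans j≡1+i (cong (suc ∘ toℕ) (sym (inverseˡ P)))))

  -- Letters of the ternary string along `P`.

  module _ (q₀≢0 : toℕ q₀ ≢ 0) where

    -- If the cuts coincided, adding `suc k` would send the common entry both to 0 and to `q₀`.
    rank-c₁≢c₂ : rank c₁ ≢ rank c₂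
    rank-c₁≢c₂ eq = q₀≢0 (trans (sym c₂-%)
      (trans (cong (λ c → (toℕ c + suc k) % N) (sym (rank-injective eq))) c₁-%))

    letterOf-cases :
      (rank c₁ < rank c₂ ×
        ∀ x → letterOf N k P x ≡ blockLetter (suc (rank c₁)) (suc (rank c₂)) (rank x)) ⊎
      (rank c₂ < rank c₁ ×
        ∀ x → letterOf N k P x ≡ blockLetter (suc (rank c₂)) (suc (rank c₁)) (rank x))
    letterOf-cases with <-cmp (rank c₁) (rank c₂)
    ... | tri≈ _ eq _ = ⊥-elim (rank-c₁≢c₂ eq)
    ... | tri< lt _ _ = inj₁ (lt , λ x → cong₂ (λ l h → blockLetter l h (rank x))
            (m≤n⇒m⊓n≡m (s≤s (<⇒≤ lt))) (m≤n⇒m⊔n≡n (s≤s (<⇒≤ lt))))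
    ... | tri> _ _ gt = inj₂ (gt , λ x → cong₂ (λ l h → blockLetter l h (rank x))
            (m≥n⇒m⊓n≡n (s≤s (<⇒≤ gt))) (m≥n⇒m⊔n≡m (s≤s (<⇒≤ gt))))

    ternaryString-stepUp : ∀ {x y} → x ⟶ y → StepUp (ternaryString N k P) x y
    ternaryString-stepUp {x} {y} x⟶y
      rewrite lookup∘tabulate (letterOf N k P) x | lookup∘tabulate (letterOf N k P) y
      with letterOf-cases
    -- Rewriting by `x⟶y` makes the rank of `y` the successor of that of `x`; off the boundaries
    -- then means off the cuts.
    ... | inj₁ (lt , eq) rewrite eq x | eq y | x⟶y
      with blockLetter-suc (suc (rank c₁)) (suc (rank c₂)) (rank x) (s≤s lt)
    ...   | inj₁ less             = inj₁ less
    ...   | inj₂ (same , ≢₁ , ≢₂) =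
      inj₂ (same , (λ x≡ → ≢₁ (cong (suc ∘ rank) x≡)) , (λ x≡ → ≢₂ (cong (suc ∘ rank) x≡)))
    ternaryString-stepUp {x} {y} x⟶y
        | inj₂ (lt , eq) rewrite eq x | eq y | x⟶y
      with blockLetter-suc (suc (rank c₂)) (suc (rank c₁)) (rank x) (s≤s lt)
    ...   | inj₁ less             = inj₁ less
    ...   | inj₂ (same , ≢₂ , ≢₁) =
      inj₂ (same , (λ x≡ → ≢₁ (cong (suc ∘ rank) x≡)) , (λ x≡ → ≢₂ (cong (suc ∘ rank) x≡)))

  -- Uniqueness of the text.

  module _ (T : String N) (sa : IsSuffixArray T P) where

    rank<⇒≺ : ∀ {x y} → rank x < rank y → suffix T x ≺ suffix T y
    rank<⇒≺ {x} {y} lt = subst₂ (λ u v → suffix T u ≺ suffix T v) (inverseʳ P) (inverseʳ P)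
      (sa (P ⟨$⟩ˡ x) (P ⟨$⟩ˡ y) lt)

    rank≤⇒≤ : ∀ {x y} → rank x ≤ rank y → lookup T x Fin.≤ lookup T y
    rank≤⇒≤ {x} {y} le with m≤n⇒m<n∨m≡n le
    ... | inj₂ eq = ≤-reflexive (cong (toℕ ∘ lookup T) (rank-injective eq))
    ... | inj₁ lt
      with _ , eqx ← suffix-head T x | _ , eqy ← suffix-head T y
      with ≺-head (subst₂ _≺_ eqx eqy (rank<⇒≺ lt))
    ...   | inj₁ Tx<Ty       = <⇒≤ Tx<Ty
    ...   | inj₂ (Tx≡Ty , _) = ≤-reflexive (cong toℕ Tx≡Ty)

    Jump : Fin N → Set
    Jump c = ∃[ d ] c ⟶ d × lookup T c Fin.< lookup T d

    -- Letters weakly increase along `P`, so the two jumps place `lookup T x` in a strict chain of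
    -- three letters: at its bottom, middle or top according to the block of `x`. Such a chain
    -- exhausts the alphabet.
    jumps⇒blocks : ∀ {c c′} → Jump c → Jump c′ → rank c < rank c′ → ∀ x →
                   lookup T x ≡ blockLetter (suc (rank c)) (suc (rank c′)) (rank x)
    jumps⇒blocks {c} {c′} (d , c⟶d , c<d) (d′ , c′⟶d′ , c′<d′) lt x
      with suc (rank c) ≤? rank x | suc (rank c′) ≤? rank x
    ... | no ¬p | _ =
      let x≤c = ≮⇒≥ ¬p
          Tx≡𝚊 , _ = three-letters {lookup T x} {lookup T d} {lookup T d′}
                       (≤-<-trans (rank≤⇒≤ x≤c) c<d) (≤-<-trans (rank≤⇒≤ d≤c′) c′<d′)
      in trans Tx≡𝚊 (sym (blockLetter-𝚊 (suc (rank c)) (suc (rank c′)) (s≤s x≤c)))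
      where
      d≤c′ : rank d ≤ rank c′
      d≤c′ = subst (_≤ rank c′) (sym c⟶d) lt
    ... | yes p | no ¬p′ =
      let _ , Tx≡𝚋 , _ = three-letters {lookup T c} {lookup T x} {lookup T d′}
                           (<-≤-trans c<d (rank≤⇒≤ (subst (_≤ rank x) (sym c⟶d) p)))
                           (≤-<-trans (rank≤⇒≤ (≮⇒≥ ¬p′)) c′<d′)
      in trans Tx≡𝚋 (sym (blockLetter-𝚋 _ (suc (rank c′)) p (≰⇒> ¬p′)))
    ... | yes p | yes p′ =
      let _ , _ , Tx≡𝚌 = three-letters {lookup T c} {lookup T c′} {lookup T x}
                           (<-≤-trans c<d (rank≤⇒≤ (subst (_≤ rank c′) (sym c⟶d) lt)))
                           (<-≤-trans c′<d′ (rank≤⇒≤ (subst (_≤ rank x) (sym c′⟶d′) p′)))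
      in trans Tx≡𝚌 (sym (blockLetter-𝚌 _ _ p p′))

    module _ (q₀≢0 : toℕ q₀ ≢ 0) (q₀≢k : toℕ q₀ ≢ k) (q₀≢m : toℕ q₀ ≢ m) where

      σ : Fin N → Fin N
      σ x = fromℕ< (m%n<n (toℕ x + k) N)

      σ-+k : ∀ x → (toℕ x + k) % N ≡ toℕ (σ x)
      σ-+k x = sym (Fin.toℕ-fromℕ< (m%n<n (toℕ x + k) N))

      suc-σ-% : ∀ x → suc (toℕ (σ x)) % N ≡ (toℕ x + suc k) % N
      suc-σ-% x = begin
        suc (toℕ (σ x)) % N        ≡⟨ cong (λ t → suc t % N) (σ-+k x) ⟨
        suc ((toℕ x + k) % N) % N  ≡⟨ suc-% N (toℕ x + k) ⟩
        suc (toℕ x + k) % N        ≡⟨ cong (_% N) (+-suc (toℕ x) k) ⟨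
        (toℕ x + suc k) % N        ∎
        where open ≡-Reasoning

      -- A text position following `σ c₁` would have to be 0.
      suc-σc₁ : suc (toℕ (σ c₁)) ≡ N
      suc-σc₁ with last⊎suc (σ c₁)
      ... | inj₁ eq = eq
      ... | inj₂ (y , y≡) = ⊥-elim (0≢1+n (trans (sym c₁-%) (trans (sym (suc-σ-% c₁))
              (trans (cong (_% N) (sym y≡)) (trans (toℕ-% y) y≡)))))

      -- Here `q₀≢0` rules out the wrap-around from the last text position to 0.
      suc-σc₂ : toℕ q₀ ≡ suc (toℕ (σ c₂))
      suc-σc₂ with last⊎suc (σ c₂)
      ... | inj₁ eq = ⊥-elim (q₀≢0 (trans (sym c₂-%) (trans (sym (suc-σ-% c₂))
              (trans (cong (_% N) eq) (n%n≡0 N)))))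
      ... | inj₂ (y , y≡) = trans (sym c₂-%) (trans (sym (suc-σ-% c₂))
              (trans (cong (_% N) (sym y≡)) (trans (toℕ-% y) y≡)))

      -- By `q₀≢m` the last text position does not head `P`, so `c₁` has a successor in `P`.
      c₁⟶ : c₁ ⟶ σ c₁
      c₁⟶ = +k⇒⟶ (σ-+k c₁) λ eq →
        q₀≢m (trans (cong toℕ (sym eq)) (suc-injective suc-σc₁))

      c₂⟶ : c₂ ⟶ σ c₂
      c₂⟶ = +k⇒⟶ (σ-+k c₂) λ eq → 1+n≢n (trans (sym suc-σc₂) (cong toℕ (sym eq)))

      -- The suffix at `σ c₁` is one letter; a smaller suffix with the same first letter would need
      -- a tail below the empty list.
      jump₁ : Jump c₁
      jump₁ with _ , eqx ← suffix-head T c₁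
            with ≺-head (subst₂ _≺_ eqx (suffix-last T suc-σc₁)
                   (rank<⇒≺ (≤-reflexive (sym c₁⟶))))
      ... | inj₁ lt = σ c₁ , c₁⟶ , lt
      ... | inj₂ (_ , base ())

      -- With equal first letters, the suffix after `c₂` would be smaller than the one at `q₀`,
      -- which is the smallest of all.
      jump₂ : Jump c₂
      jump₂ with last⊎suc c₂
      -- If `c₂` ended the text, adding `suc k` would give `k`, that is `p₁ = k + 1`.
      ... | inj₁ c₂-last = ⊥-elim (q₀≢k (begin
        toℕ q₀                ≡⟨ c₂-% ⟨
        (toℕ c₂ + suc k) % N  ≡⟨ cong (_% N) (+-suc (toℕ c₂) k) ⟩
        (suc (toℕ c₂) + k) % N ≡⟨ cong (λ t → (t + k) % N) c₂-last ⟩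
        (N + k) % N           ≡⟨ cong (_% N) (+-comm N k) ⟩
        (k + N) % N           ≡⟨ [m+n]%n≡m%n k N ⟩
        k % N                 ≡⟨ m<n⇒m%n≡m k<n ⟩
        k                     ∎))
        where open ≡-Reasoning
      ... | inj₂ (c₂⁺ , c₂⁺≡)
            with ≺-head (subst₂ _≺_ (suffix-suc T c₂⁺≡) (suffix-suc T suc-σc₂)
                   (rank<⇒≺ (≤-reflexive (sym c₂⟶))))
      ...   | inj₁ lt = σ c₂ , c₂⟶ , lt
      ...   | inj₂ (_ , c₂⁺≺q₀) with rank q₀ <? rank c₂⁺
      ...     | yes lt = ⊥-elim (≺-asym c₂⁺≺q₀ (rank<⇒≺ lt))
      -- Here `c₂⁺` has rank 0 as well, so it is `q₀` and its suffix would precede itself.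
      ...     | no ≮ with refl ← rank-injective {c₂⁺} {q₀}
                       (≤-antisym (≮⇒≥ ≮) (subst (_≤ rank c₂⁺) (sym rank-q₀) z≤n))
                     = ⊥-elim (≺-asym c₂⁺≺q₀ c₂⁺≺q₀)

      unique : T ≡ ternaryString N k P
      unique = trans (sym (tabulate∘lookup T)) (tabulate-cong lookup≡)
        where
        lookup≡ : ∀ x → lookup T x ≡ letterOf N k P x
        lookup≡ x with letterOf-cases q₀≢0
        ... | inj₁ (lt , eq) = trans (jumps⇒blocks jump₁ jump₂ lt x) (sym (eq x))
        ... | inj₂ (lt , eq) = trans (jumps⇒blocks jump₂ jump₁ lt x) (sym (eq x))

theorem7 : (n : ℕ) .{{_ : NonZero n}} → 2 ≤ n →
    (k : ℕ) (P : Permutation′ n) → ArithmeticallyProgressed n k P →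
    ⟦ first P ⟧ ≢ 1 → ⟦ first P ⟧ ≢ suc k → ⟦ first P ⟧ ≢ n →
    IsSuffixArray (ternaryString n k P) P
    × (∀ (T : String n) → IsSuffixArray T P → T ≡ ternaryString n k P)
theorem7 (suc m) 2≤n k P ap ≢1 ≢1+k ≢n =
  isSuffixArray m k P ap _ (ternaryString-stepUp m k P ap (≢1 ∘ cong suc)) ,
  λ T sa → unique m k P ap T sa (≢1 ∘ cong suc) (≢1+k ∘ cong suc) (≢n ∘ cong suc)
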